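{- Let $G$ be a graph with at least one edge. Then $\alpha_{\rm es}(G)=\alpha(G)-1$ if and only if either $G=K_n$ for some $n\geq 2$, or for every $\alpha_{\rm es}(G)$-set $B$ the following two conditions hold: (i) the set $D=V(G)- N[B]$ induces a complete graph, and (ii) for every subset $B'\subseteq B$, $\alpha(G[\mathrm{epn}(B',B)\cup D]) \leq |B'|+1$.
   Context: All graphs are finite and simple; $\alpha(G)$ is the independence number and $G[S]$ is the subgraph of $G$ induced by $S$. For $B\subseteq V(G)$, $N[B]=\bigcup_{b\in B}N[b]$ and $N(B)=N[B]- B$. A set $B\subseteq V(G)$ is an externally supported independence set (ESI-set) if $B$ is independent and every $v\in N(B)$ has a neighbor in $V(G)- N[B]$ (the empty set is an ESI-set). $\alpha_{\rm es}(G)$ is the maximum cardinality of an ESI-set of $G$, and an $\alpha_{\rm es}(G)$-set is an ESI-set of cardinality $\alpha_{\rm es}(G)$. For an ESI-set $B$ and $B'\subseteq B$, the external private neighborhood of $B'$ with respect to $B$ is $\mathrm{epn}(B',B)=N(B')- N(B- B')$, i.e. the set of all vertices adjacent to at least one vertex of $B'$ and to no vertex of $B- B'$. -}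

module Defs where

open import Data.Fin.Base using (Fin; zero; suc)
open import Data.Fin.Properties using (_≟_; all?; any?)
open import Data.Fin.Subset
open import Data.Fin.Subset.Properties using (_∈?_)
open import Data.List.Base using (List; []; _∷_; _++_; map; filter)
open import Data.List.Extrema.Nat using (max; v≤max⁺; argmax-sel)
import Data.List.Membership.Propositional as List
open import Data.List.Membership.Propositional.Properties
  using (∈-map⁺; ∈-map⁻; ∈-++⁺ˡ; ∈-++⁺ʳ; ∈-filter⁺; ∈-filter⁻)
open import Data.List.Relation.Unary.Any as Any using (here)
open import Data.Nat.Base using (ℕ; zero; suc; _≤_; z≤n)
open import Data.Nat.Properties using (≤-reflexive; ≤-antisym; ≤-trans)
open import Data.Product.Base using (∃; _×_; _,_)
open import Data.Sum.Base using (inj₁; inj₂)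
import Data.Vec.Base as Vec
open import Function.Base using (_∘_; _on_)
open import Function.Bundles using (_↔_; _⇔_; Inverse)
open import Level using (0ℓ)
open import Relation.Binary.Core using (Rel)
open import Relation.Binary.Definitions using (Symmetric; Decidable)
open import Relation.Binary.PropositionalEquality
  using (_≡_; _≢_; refl; sym; ≢-sym)
open import Relation.Nullary.Decidable using (does; ¬?; _×-dec_; _⊎-dec_; _→-dec_)
open import Relation.Nullary.Negation using (¬_)
import Relation.Unary as Unary

-- Finite simple graphs with vertex set Fin n.
record Graph (n : ℕ) : Set₁ where
  field
    Adj    : Rel (Fin n) 0ℓ
    adj?   : Decidable Adj
    symm   : Symmetric Adj
    irrefl : ∀ {v} → ¬ Adj v v

open Graph public

HasEdge : ∀ {n} → Graph n → Set
HasEdge G = ∃ λ u → ∃ λ v → Adj G u v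

Complete : ∀ {n} → Graph n → Set
Complete G = ∀ {u v} → u ≢ v → Adj G u v

K : ∀ n → Graph n
K n = record
  { Adj    = _≢_
  ; adj?   = λ u v → ¬? (u ≟ v)
  ; symm   = ≢-sym
  ; irrefl = λ v≢v → v≢v refl
  }

infix 4 _≅_

record _≅_ {m n : ℕ} (G : Graph m) (H : Graph n) : Set where
  field
    bijection : Fin m ↔ Fin n
    adj⇔      : ∀ u v → Adj G u v ⇔ Adj H (Inverse.to bijection u) (Inverse.to bijection v)

-- The increasing enumeration of the elements of S.
element : ∀ {n} (S : Subset n) → Fin ∣ S ∣ → Fin n
element (inside  Vec.∷ S) zero    = zero
element (inside  Vec.∷ S) (suc i) = suc (element S i)
element (outside Vec.∷ S) i       = suc (element S i)

-- G[S], with the elements of S relabelled by Fin ∣ S ∣.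
induced : ∀ {n} → Graph n → (S : Subset n) → Graph ∣ S ∣
induced G S = record
  { Adj    = Adj G on element S
  ; adj?   = λ i j → adj? G (element S i) (element S j)
  ; symm   = symm G
  ; irrefl = irrefl G
  }

comprehension : ∀ {n} {P : Unary.Pred (Fin n) 0ℓ} → Unary.Decidable P → Subset n
comprehension P? = Vec.tabulate (does ∘ P?)

subsets : ∀ n → List (Subset n)
subsets zero    = Vec.[] ∷ []
subsets (suc n) = map (outside Vec.∷_) (subsets n) ++ map (inside Vec.∷_) (subsets n)

-- The largest cardinality of a subset satisfying P (0 if there is none).
maxCard : ∀ {n} {P : Unary.Pred (Subset n) 0ℓ} → Unary.Decidable P → ℕ
maxCard {n} P? = max 0 (map ∣_∣ (filter P? (subsets n)))

∈-subsets : ∀ {n} (S : Subset n) → S List.∈ subsets n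
∈-subsets Vec.[]              = here refl
∈-subsets (outside Vec.∷ S) = ∈-++⁺ˡ (∈-map⁺ (outside Vec.∷_) (∈-subsets S))
∈-subsets {suc n} (inside Vec.∷ S) =
  ∈-++⁺ʳ (map (outside Vec.∷_) (subsets n)) (∈-map⁺ (inside Vec.∷_) (∈-subsets S))

maxCard-upper : ∀ {n} {P : Unary.Pred (Subset n) 0ℓ} (P? : Unary.Decidable P) →
                ∀ {S} → P S → ∣ S ∣ ≤ maxCard P?
maxCard-upper {n} P? {S} PS =
  v≤max⁺ 0 (map ∣_∣ (filter P? (subsets n)))
    (inj₂ (Any.map ≤-reflexive (∈-map⁺ ∣_∣ (∈-filter⁺ P? (∈-subsets S) PS))))

maxCard-attained : ∀ {n} {P : Unary.Pred (Subset n) 0ℓ} (P? : Unary.Decidable P) →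
                   ∃ P → ∃ λ S → P S × ∣ S ∣ ≡ maxCard P?
maxCard-attained {n} P? (S , PS)
  with argmax-sel (λ k → k) 0 (map ∣_∣ (filter P? (subsets n)))
... | inj₁ max≡0 =
  S , PS , ≤-antisym (maxCard-upper P? PS) (≤-trans (≤-reflexive max≡0) z≤n)
... | inj₂ max∈ with ∈-map⁻ ∣_∣ max∈
...   | T , T∈ , max≡∣T∣ with ∈-filter⁻ P? {xs = subsets n} T∈
...     | _ , PT = T , PT , sym max≡∣T∣

module _ {n : ℕ} (G : Graph n) where

  Independent : Subset n → Set
  Independent S = ∀ u → u ∈ S → ∀ v → v ∈ S → ¬ Adj G u v

  independent? : Unary.Decidable Independent
  independent? S = all? λ u → (u ∈? S) →-dec (all? λ v → (v ∈? S) →-dec ¬? (adj? G u v))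

  α : ℕ
  α = maxCard independent?

  closedNbhd₁ : Fin n → Subset n
  closedNbhd₁ b = comprehension λ v → (v ≟ b) ⊎-dec adj? G b v

  -- N[B]
  closedNbhd : Subset n → Subset n
  closedNbhd B = comprehension λ v → any? λ b → (b ∈? B) ×-dec (v ∈? closedNbhd₁ b)

  -- N(B), which excludes B itself
  openNbhd : Subset n → Subset n
  openNbhd B = closedNbhd B ─ B

  -- V(G) - N[B]
  exterior : Subset n → Subset n
  exterior B = ∁ (closedNbhd B)

  ESI : Subset n → Set
  ESI B = Independent B ×
          (∀ v → v ∈ openNbhd B → ∃ λ w → w ∈ exterior B × Adj G v w)

  esi? : Unary.Decidable ESI
  esi? B = independent? B ×-dec
           (all? λ v → (v ∈? openNbhd B) →-dec
             (any? λ w → (w ∈? exterior B) ×-dec adj? G v w))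

  αₑₛ : ℕ
  αₑₛ = maxCard esi?

  MaximumESI : Subset n → Set
  MaximumESI B = ESI B × ∣ B ∣ ≡ αₑₛ

  -- epn(B′, B)
  epn : Subset n → Subset n → Subset n
  epn B′ B = openNbhd B′ ─ openNbhd (B ─ B′)

{-# OPTIONS --safe #-}
-- The bound αₑₛ ≤ α ∸ 1 holds as soon as there is an edge: the exterior of an ESI-set B is
-- then nonempty, and any vertex of it extends B independently.  So the question is whether
-- α ≤ ∣ B ∣ + 1 for a maximum ESI-set B.  If it is, replacing B′ ⊆ B by an independent subset
-- of epn(B′, B) ∪ D keeps B independent, which gives (ii), and (i) is essentially the case
-- B′ = ∅.  Conversely, for a maximum independent set I put B′ = B ─ I; then I ─ B lies in
-- epn(B′, B) ∪ D, and (ii) bounds ∣ I ∣ by ∣ B ∣ + 1.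
module Submission where

open import Defs
open import Data.Fin.Base using (Fin; zero; suc)
open import Data.Fin.Properties using (_≟_; any?; suc-injective)
open import Data.Fin.Subset
  using (Subset; inside; outside; _∈_; _∉_; _⊆_; _∪_; _∩_; _─_; ⊥; ⁅_⁆; ∣_∣)
open import Data.Fin.Subset.Properties
open import Data.Nat.Base using (ℕ; suc; _+_; _∸_; _≤_; z≤n)
open import Data.Nat.Properties
  using (+-suc; +-comm; +-assoc; +-monoˡ-≤; +-monoʳ-≤; +-cancelˡ-≤; ∸-monoˡ-≤;
         ≤-antisym; ≤-reflexive; ≤-trans; m+n∸n≡m; m≤n+m∸n; 1+n≰n; module ≤-Reasoning)
open import Data.Product.Base using (∃; _×_; _,_; proj₂)
open import Data.Sum.Base using (_⊎_; inj₁; inj₂)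
open import Data.Vec.Base using ([]; _∷_; here; there)
open import Data.Vec.Properties using (lookup∘tabulate; lookup⇒[]=; []=⇒lookup)
open import Function.Base using (_∘_)
open import Function.Bundles using (_⇔_; mk⇔; Inverse; Equivalence)
open import Level using (0ℓ)
open import Relation.Binary.PropositionalEquality
  using (_≡_; refl; sym; trans; cong; cong₂; subst; subst₂)
open import Relation.Nullary.Decidable using (yes; no; _×-dec_; _⊎-dec_; dec-true; decidable-stable)
open import Relation.Nullary.Negation using (¬_; contradiction)
import Relation.Unary as Unary

private
  variable
    m n : ℕ
    v x y : Fin n

-- Finite subsets

∣p∩q∣+∣p─q∣≡∣p∣ : ∀ (p q : Subset n) → ∣ p ∩ q ∣ + ∣ p ─ q ∣ ≡ ∣ p ∣
∣p∩q∣+∣p─q∣≡∣p∣ []            []            = refl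
∣p∩q∣+∣p─q∣≡∣p∣ (inside  ∷ p) (inside  ∷ q) = cong suc (∣p∩q∣+∣p─q∣≡∣p∣ p q)
∣p∩q∣+∣p─q∣≡∣p∣ (inside  ∷ p) (outside ∷ q) =
  trans (+-suc ∣ p ∩ q ∣ ∣ p ─ q ∣) (cong suc (∣p∩q∣+∣p─q∣≡∣p∣ p q))
∣p∩q∣+∣p─q∣≡∣p∣ (outside ∷ p) (inside  ∷ q) = ∣p∩q∣+∣p─q∣≡∣p∣ p q
∣p∩q∣+∣p─q∣≡∣p∣ (outside ∷ p) (outside ∷ q) = ∣p∩q∣+∣p─q∣≡∣p∣ p q

disjoint⇒∣p∪q∣≡∣p∣+∣q∣ : ∀ (p q : Subset n) → (∀ {x} → x ∈ p → x ∉ q) →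
                         ∣ p ∪ q ∣ ≡ ∣ p ∣ + ∣ q ∣
disjoint⇒∣p∪q∣≡∣p∣+∣q∣ []            []            p#q = refl
disjoint⇒∣p∪q∣≡∣p∣+∣q∣ (inside  ∷ p) (inside  ∷ q) p#q = contradiction here (p#q here)
disjoint⇒∣p∪q∣≡∣p∣+∣q∣ (inside  ∷ p) (outside ∷ q) p#q =
  cong suc (disjoint⇒∣p∪q∣≡∣p∣+∣q∣ p q λ x∈p x∈q → p#q (there x∈p) (there x∈q))
disjoint⇒∣p∪q∣≡∣p∣+∣q∣ (outside ∷ p) (inside  ∷ q) p#q =
  trans (cong suc (disjoint⇒∣p∪q∣≡∣p∣+∣q∣ p q λ x∈p x∈q → p#q (there x∈p) (there x∈q)))
        (sym (+-suc ∣ p ∣ ∣ q ∣))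
disjoint⇒∣p∪q∣≡∣p∣+∣q∣ (outside ∷ p) (outside ∷ q) p#q =
  disjoint⇒∣p∪q∣≡∣p∣+∣q∣ p q λ x∈p x∈q → p#q (there x∈p) (there x∈q)

x∈p─q⇒x∉q : ∀ (p q : Subset n) → x ∈ p ─ q → x ∉ q
x∈p─q⇒x∉q (_ ∷ p) (inside  ∷ q) (there x∈p─q) (there x∈q) = x∈p─q⇒x∉q p q x∈p─q x∈q
x∈p─q⇒x∉q (_ ∷ p) (outside ∷ q) (there x∈p─q) (there x∈q) = x∈p─q⇒x∉q p q x∈p─q x∈q

subsingleton⇒∣p∣≤1 : ∀ (p : Subset n) → (∀ {x y} → x ∈ p → y ∈ p → x ≡ y) → ∣ p ∣ ≤ 1
subsingleton⇒∣p∣≤1 {n} p x≡y with nonempty? p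
... | yes (x , x∈p) = ≤-trans (p⊆q⇒∣p∣≤∣q∣ p⊆⁅x⁆) (≤-reflexive (∣⁅x⁆∣≡1 x))
  where
  p⊆⁅x⁆ : p ⊆ ⁅ x ⁆
  p⊆⁅x⁆ y∈p = subst (_∈ ⁅ x ⁆) (x≡y x∈p y∈p) (x∈⁅x⁆ x)
... | no p-empty =
  ≤-trans (≤-reflexive (trans (cong ∣_∣ (Empty-unique p-empty)) (∣⊥∣≡0 n))) z≤n

module _ {P : Unary.Pred (Fin n) 0ℓ} (P? : Unary.Decidable P) where

  ∈-comprehension⁺ : P x → x ∈ comprehension P?
  ∈-comprehension⁺ {x} Px =
    lookup⇒[]= x _ (trans (lookup∘tabulate _ x) (dec-true (P? x) Px))

  ∈-comprehension⁻ : x ∈ comprehension P? → P x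
  -- Abstracting `P? x` together with the equation turns the latter into an absurd
  -- `outside ≡ inside` when the answer is `no`.
  ∈-comprehension⁻ {x} x∈ with P? x | trans (sym (lookup∘tabulate _ x)) ([]=⇒lookup x∈)
  ... | yes Px | _  = Px
  ... | no _   | ()

-- Passing between subsets of an induced subgraph and subsets of the whole vertex set

element-∈ : ∀ (S : Subset n) i → element S i ∈ S
element-∈ (inside  ∷ S) zero    = here
element-∈ (inside  ∷ S) (suc i) = there (element-∈ S i)
element-∈ (outside ∷ S) i       = there (element-∈ S i)

element-injective : ∀ (S : Subset n) {i j} → element S i ≡ element S j → i ≡ j
element-injective (inside  ∷ S) {zero}  {zero}  _  = refl
element-injective (inside  ∷ S) {suc i} {suc j} eq =
  cong suc (element-injective S (suc-injective eq))
element-injective (outside ∷ S)                 eq = element-injective S (suc-injective eq)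

-- The preimage of the second argument under `element S`. Elements outside `S` are dropped, so
-- cardinality is preserved only for subsets of `S`.
restrict : (S : Subset n) → Subset n → Subset ∣ S ∣
restrict []            []      = []
restrict (inside  ∷ S) (t ∷ T) = t ∷ restrict S T
restrict (outside ∷ S) (_ ∷ T) = restrict S T

∈-restrict⁻ : ∀ (S T : Subset n) {i} → i ∈ restrict S T → element S i ∈ T
∈-restrict⁻ (inside  ∷ S) (_ ∷ T) here       = here
∈-restrict⁻ (inside  ∷ S) (_ ∷ T) (there i∈) = there (∈-restrict⁻ S T i∈)
∈-restrict⁻ (outside ∷ S) (_ ∷ T) i∈         = there (∈-restrict⁻ S T i∈)

∣restrict∣ : ∀ (S T : Subset n) → T ⊆ S → ∣ restrict S T ∣ ≡ ∣ T ∣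
∣restrict∣ []            []            T⊆S = refl
∣restrict∣ (inside  ∷ S) (inside  ∷ T) T⊆S = cong suc (∣restrict∣ S T (drop-∷-⊆ T⊆S))
∣restrict∣ (inside  ∷ S) (outside ∷ T) T⊆S = ∣restrict∣ S T (drop-∷-⊆ T⊆S)
∣restrict∣ (outside ∷ S) (inside  ∷ T) T⊆S = contradiction (T⊆S here) λ ()
∣restrict∣ (outside ∷ S) (outside ∷ T) T⊆S = ∣restrict∣ S T (drop-∷-⊆ T⊆S)

-- The image of the second argument under `element S`.
extend : (S : Subset n) → Subset ∣ S ∣ → Subset n
extend []            []      = []
extend (inside  ∷ S) (t ∷ T) = t ∷ extend S T
extend (outside ∷ S) T       = outside ∷ extend S T

∈-extend⁻ : ∀ (S : Subset n) T → x ∈ extend S T → ∃ λ i → i ∈ T × element S i ≡ x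
∈-extend⁻ (inside  ∷ S) (_ ∷ T) here = zero , here , refl
∈-extend⁻ (inside  ∷ S) (_ ∷ T) (there x∈) with ∈-extend⁻ S T x∈
... | i , i∈T , eq = suc i , there i∈T , cong suc eq
∈-extend⁻ (outside ∷ S) T (there x∈) with ∈-extend⁻ S T x∈
... | i , i∈T , eq = i , i∈T , cong suc eq

∣extend∣ : ∀ (S : Subset n) T → ∣ extend S T ∣ ≡ ∣ T ∣
∣extend∣ []            []            = refl
∣extend∣ (inside  ∷ S) (inside  ∷ T) = cong suc (∣extend∣ S T)
∣extend∣ (inside  ∷ S) (outside ∷ T) = ∣extend∣ S T
∣extend∣ (outside ∷ S) T             = ∣extend∣ S T

-- Independent sets

module _ (G : Graph n) where

  ⊥-independent : Independent G ⊥
  ⊥-independent _ u∈⊥ = contradiction u∈⊥ ∉⊥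

  ⁅x⁆-independent : ∀ x → Independent G ⁅ x ⁆
  ⁅x⁆-independent x u u∈ v v∈ with x∈⁅y⁆⇒x≡y x u∈ | x∈⁅y⁆⇒x≡y x v∈
  ... | refl | refl = irrefl G

  independent-∪ : ∀ {A C} → Independent G A → Independent G C →
                  (∀ {a c} → a ∈ A → c ∈ C → ¬ Adj G a c) → Independent G (A ∪ C)
  independent-∪ {A} {C} A-ind C-ind A≁C u u∈ v v∈ with x∈p∪q⁻ A C u∈ | x∈p∪q⁻ A C v∈
  ... | inj₁ u∈A | inj₁ v∈A = A-ind u u∈A v v∈A
  ... | inj₁ u∈A | inj₂ v∈C = A≁C u∈A v∈C
  ... | inj₂ u∈C | inj₁ v∈A = A≁C v∈A u∈C ∘ symm G
  ... | inj₂ u∈C | inj₂ v∈C = C-ind u u∈C v v∈C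

  independent-⊆ : ∀ {A C} → A ⊆ C → Independent G C → Independent G A
  independent-⊆ A⊆C C-ind u u∈A v v∈A = C-ind u (A⊆C u∈A) v (A⊆C v∈A)

  ∣A∣+∣C∣≤α : ∀ {A C} → Independent G A → Independent G C → (∀ {x} → x ∈ A → x ∉ C) →
              (∀ {a c} → a ∈ A → c ∈ C → ¬ Adj G a c) → ∣ A ∣ + ∣ C ∣ ≤ α G
  ∣A∣+∣C∣≤α {A} {C} A-ind C-ind A#C A≁C =
    subst (_≤ α G) (disjoint⇒∣p∪q∣≡∣p∣+∣q∣ A C A#C)
      (maxCard-upper (independent? G) (independent-∪ A-ind C-ind A≁C))

α-least : ∀ (G : Graph n) {k} → (∀ I → Independent G I → ∣ I ∣ ≤ k) → α G ≤ k
α-least G bound with maxCard-attained (independent? G) (⊥ , ⊥-independent G)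
... | I , I-ind , ∣I∣≡α = subst (_≤ _) ∣I∣≡α (bound I I-ind)

-- Together with `α-induced-least`, this reduces the independence number of an induced subgraph to
-- independent sets of `G` inside `S`, so later arguments never meet the relabelling.
∣I∣≤α-induced : ∀ (G : Graph n) {S I} → I ⊆ S → Independent G I → ∣ I ∣ ≤ α (induced G S)
∣I∣≤α-induced G {S} {I} I⊆S I-ind = subst (_≤ α (induced G S)) (∣restrict∣ S I I⊆S)
  (maxCard-upper (independent? (induced G S))
    λ i i∈ j j∈ → I-ind _ (∈-restrict⁻ S I i∈) _ (∈-restrict⁻ S I j∈))

α-induced-least : ∀ (G : Graph n) S {k} → (∀ I → I ⊆ S → Independent G I → ∣ I ∣ ≤ k) →
                  α (induced G S) ≤ k
α-induced-least G S bound = α-least (induced G S) λ J J-ind →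
  subst (_≤ _) (∣extend∣ S J) (bound (extend S J) (extend-⊆ J) (extend-ind J J-ind))
  where
  extend-⊆ : ∀ J → extend S J ⊆ S
  extend-⊆ J x∈ with ∈-extend⁻ S J x∈
  ... | i , _ , refl = element-∈ S i

  extend-ind : ∀ J → Independent (induced G S) J → Independent G (extend S J)
  extend-ind J J-ind u u∈ v v∈ with ∈-extend⁻ S J u∈ | ∈-extend⁻ S J v∈
  ... | i , i∈J , refl | j , j∈J , refl = J-ind i i∈J j j∈J

α-complete : ∀ (G : Graph n) → Complete G → α G ≤ 1
α-complete G complete = α-least G λ I I-ind → subsingleton⇒∣p∣≤1 I λ {x} {y} x∈I y∈I →
  decidable-stable (x ≟ y) λ x≢y → I-ind x x∈I y y∈I (complete x≢y)

≅K⇒complete : ∀ (G : Graph n) → G ≅ K m → Complete G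
≅K⇒complete G G≅K {u} {v} u≢v =
  Equivalence.from (adj⇔ u v) λ eq →
    u≢v (trans (sym (Inverse.strictlyInverseʳ bijection u))
        (trans (cong (Inverse.from bijection) eq) (Inverse.strictlyInverseʳ bijection v)))
  where open _≅_ G≅K

-- Neighbourhoods and ESI-sets

module _ (G : Graph n) where

  -- The very decision procedure inside `closedNbhd₁`, named so that the comprehension lemmas apply
  -- to it by unfolding.
  ∈-closedNbhd₁? : ∀ b → Unary.Decidable (λ v → v ≡ b ⊎ Adj G b v)
  ∈-closedNbhd₁? b v = (v ≟ b) ⊎-dec adj? G b v

  ∈-closedNbhd? : ∀ B → Unary.Decidable (λ v → ∃ λ b → b ∈ B × v ∈ closedNbhd₁ G b)
  ∈-closedNbhd? B v = any? λ b → (b ∈? B) ×-dec (v ∈? closedNbhd₁ G b)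

  ∈-closedNbhd⁺ : ∀ {B b} → b ∈ B → v ≡ b ⊎ Adj G b v → v ∈ closedNbhd G B
  ∈-closedNbhd⁺ {B = B} {b} b∈B b∼v =
    ∈-comprehension⁺ (∈-closedNbhd? B) (b , b∈B , ∈-comprehension⁺ (∈-closedNbhd₁? b) b∼v)

  ∈-closedNbhd⁻ : ∀ {B} → v ∈ closedNbhd G B → ∃ λ b → b ∈ B × (v ≡ b ⊎ Adj G b v)
  ∈-closedNbhd⁻ {B = B} v∈ with ∈-comprehension⁻ (∈-closedNbhd? B) v∈
  ... | b , b∈B , v∈N[b] = b , b∈B , ∈-comprehension⁻ (∈-closedNbhd₁? b) v∈N[b]

  ∈-openNbhd⁺ : ∀ {B b} → b ∈ B → Adj G b v → v ∉ B → v ∈ openNbhd G B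
  ∈-openNbhd⁺ b∈B b∼v v∉B = x∈p∧x∉q⇒x∈p─q (∈-closedNbhd⁺ b∈B (inj₂ b∼v)) v∉B

  ∈-openNbhd⁻ : ∀ B → v ∈ openNbhd G B → v ∉ B × ∃ λ b → b ∈ B × Adj G b v
  ∈-openNbhd⁻ B v∈ with x∈p─q⇒x∉q (closedNbhd G B) B v∈
                       | ∈-closedNbhd⁻ (p─q⊆p (closedNbhd G B) B v∈)
  ... | v∉B | b , b∈B , inj₁ refl = contradiction b∈B v∉B
  ... | v∉B | b , b∈B , inj₂ b∼v  = v∉B , b , b∈B , b∼v

  exterior-∉ : ∀ {B} → v ∈ exterior G B → v ∉ B
  exterior-∉ v∈D v∈B = x∈∁p⇒x∉p v∈D (∈-closedNbhd⁺ v∈B (inj₁ refl))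

  exterior-≁ : ∀ {B b} → v ∈ exterior G B → b ∈ B → ¬ Adj G b v
  exterior-≁ v∈D b∈B b∼v = x∈∁p⇒x∉p v∈D (∈-closedNbhd⁺ b∈B (inj₂ b∼v))

  ⊥-ESI : ESI G ⊥
  ⊥-ESI = ⊥-independent G , λ v v∈ →
    let _ , _ , b∈⊥ , _ = ∈-openNbhd⁻ ⊥ v∈ in contradiction b∈⊥ ∉⊥

  ∃-maximumESI : ∃ (MaximumESI G)
  ∃-maximumESI = maxCard-attained (esi? G) (⊥ , ⊥-ESI)

  -- For an edge uv, either u is already exterior, or u lies in N(B) and its support is an exterior
  -- vertex, or u lies in B. In the last case independence puts v in N(B), and the support of v
  -- serves.
  ESI⇒exterior-nonempty : HasEdge G → ∀ {B} → ESI G B → ∃ λ w → w ∈ exterior G B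
  ESI⇒exterior-nonempty (u , v , u∼v) {B} (B-ind , support) with u ∈? closedNbhd G B
  ... | no u∉N[B] = u , x∉p⇒x∈∁p u∉N[B]
  ... | yes u∈N[B] with u ∈? B
  ...   | no u∉B  = let w , w∈D , _ = support u (x∈p∧x∉q⇒x∈p─q u∈N[B] u∉B) in w , w∈D
  ...   | yes u∈B =
    let w , w∈D , _ = support v (∈-openNbhd⁺ u∈B u∼v λ v∈B → B-ind u u∈B v v∈B u∼v)
    in w , w∈D

  -- A maximum ESI-set stays independent when a vertex of its exterior is added. The additive form
  -- avoids truncated subtraction.
  αₑₛ+1≤α : HasEdge G → αₑₛ G + 1 ≤ α G
  αₑₛ+1≤α edge with ∃-maximumESI
  ... | B , B-esi@(B-ind , _) , ∣B∣≡αₑₛ with ESI⇒exterior-nonempty edge B-esi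
  ...   | w , w∈D = subst₂ (λ a b → a + b ≤ α G) ∣B∣≡αₑₛ (∣⁅x⁆∣≡1 w)
    (∣A∣+∣C∣≤α G B-ind (⁅x⁆-independent G w)
      (λ b∈B b∈⁅w⁆ → exterior-∉ w∈D (subst (_∈ B) (x∈⁅y⁆⇒x≡y w b∈⁅w⁆) b∈B))
      (λ {b} b∈B c∈⁅w⁆ b∼c →
        exterior-≁ w∈D b∈B (subst (Adj G b) (x∈⁅y⁆⇒x≡y w c∈⁅w⁆) b∼c)))

  αₑₛ≤α∸1 : HasEdge G → αₑₛ G ≤ α G ∸ 1
  αₑₛ≤α∸1 edge = subst (_≤ α G ∸ 1) (m+n∸n≡m (αₑₛ G) 1) (∸-monoˡ-≤ 1 (αₑₛ+1≤α edge))

  -- Exchanging a part of an independent set for external private neighbours and exterior vertices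

  module _ {B B′} (B-ind : Independent G B) (B′⊆B : B′ ⊆ B) where

    -- Such a vertex has a neighbour in B′, hence in the independent set B.
    epn-∉ : v ∈ epn G B′ B → v ∉ B
    epn-∉ {v} v∈ v∈B with ∈-openNbhd⁻ B′ (p─q⊆p (openNbhd G B′) _ v∈)
    ... | _ , b , b∈B′ , b∼v = B-ind b (B′⊆B b∈B′) v v∈B b∼v

    -- Since `openNbhd` excludes the set itself, being outside it rules out adjacency only for
    -- vertices outside `B ─ B′`; `epn-∉` guarantees that.
    epn-≁ : ∀ {b} → v ∈ epn G B′ B → b ∈ B ─ B′ → ¬ Adj G b v
    epn-≁ v∈ b∈ b∼v = x∈p─q⇒x∉q (openNbhd G B′) (openNbhd G (B ─ B′)) v∈
      (∈-openNbhd⁺ b∈ b∼v (epn-∉ v∈ ∘ p─q⊆p B B′))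

    -- Neither private neighbours of B′ nor exterior vertices meet or touch `B ─ B′`, so `I` can
    -- take the place of B′.
    exchange : ∀ {I} → I ⊆ epn G B′ B ∪ exterior G B → Independent G I →
               ∣ B ─ B′ ∣ + ∣ I ∣ ≤ α G
    exchange {I} I⊆ I-ind = ∣A∣+∣C∣≤α G (independent-⊆ G (p─q⊆p B B′) B-ind) I-ind disjoint ≁
      where
      disjoint : ∀ {x} → x ∈ B ─ B′ → x ∉ I
      disjoint x∈ x∈I with x∈p∪q⁻ (epn G B′ B) _ (I⊆ x∈I)
      ... | inj₁ x∈epn = epn-∉ x∈epn (p─q⊆p B B′ x∈)
      ... | inj₂ x∈D   = exterior-∉ x∈D (p─q⊆p B B′ x∈)

      ≁ : ∀ {b c} → b ∈ B ─ B′ → c ∈ I → ¬ Adj G b c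
      ≁ b∈ c∈I with x∈p∪q⁻ (epn G B′ B) _ (I⊆ c∈I)
      ... | inj₁ c∈epn = epn-≁ c∈epn b∈
      ... | inj₂ c∈D   = exterior-≁ c∈D (p─q⊆p B B′ b∈)

    -- Cancelling `∣ B ─ B′ ∣` from the exchange inequality leaves the bound of condition (ii).
    independent-bound : α G ≤ ∣ B ∣ + 1 → ∀ {I} → I ⊆ epn G B′ B ∪ exterior G B →
                        Independent G I → ∣ I ∣ ≤ ∣ B′ ∣ + 1
    independent-bound α≤ {I} I⊆ I-ind = +-cancelˡ-≤ ∣ B ─ B′ ∣ _ _ (begin
      ∣ B ─ B′ ∣ + ∣ I ∣                 ≤⟨ exchange I⊆ I-ind ⟩
      α G                                ≤⟨ α≤ ⟩
      ∣ B ∣ + 1                          ≡⟨ cong (_+ 1) (∣p∩q∣+∣p─q∣≡∣p∣ B B′) ⟨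
      ∣ B ∩ B′ ∣ + ∣ B ─ B′ ∣ + 1        ≤⟨ +-monoˡ-≤ 1 (+-monoˡ-≤ ∣ B ─ B′ ∣ (∣p∩q∣≤∣q∣ B B′)) ⟩
      ∣ B′ ∣ + ∣ B ─ B′ ∣ + 1            ≡⟨ cong (_+ 1) (+-comm ∣ B′ ∣ ∣ B ─ B′ ∣) ⟩
      ∣ B ─ B′ ∣ + ∣ B′ ∣ + 1            ≡⟨ +-assoc ∣ B ─ B′ ∣ ∣ B′ ∣ 1 ⟩
      ∣ B ─ B′ ∣ + (∣ B′ ∣ + 1)          ∎)
      where open ≤-Reasoning

  -- Two nonadjacent exterior vertices would form an independent set of size 2, whereas the exchange
  -- bound with B′ empty allows at most 1.
  exterior-complete : ∀ {B} → Independent G B → α G ≤ ∣ B ∣ + 1 →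
                      Complete (induced G (exterior G B))
  exterior-complete {B} B-ind α≤ {i} {j} i≢j =
    decidable-stable (adj? G a c) λ a≁c → 1+n≰n (begin
      2                      ≡⟨ cong₂ _+_ (∣⁅x⁆∣≡1 a) (∣⁅x⁆∣≡1 c) ⟨
      ∣ ⁅ a ⁆ ∣ + ∣ ⁅ c ⁆ ∣  ≡⟨ disjoint⇒∣p∪q∣≡∣p∣+∣q∣ ⁅ a ⁆ ⁅ c ⁆ disjoint ⟨
      ∣ ⁅ a ⁆ ∪ ⁅ c ⁆ ∣      ≤⟨ independent-bound B-ind (λ b∈⊥ → contradiction b∈⊥ ∉⊥) α≤ pair⊆
                                  (independent-∪ G (⁅x⁆-independent G a) (⁅x⁆-independent G c)
                                    (λ u∈ v∈ → a≁c ∘ subst₂ (Adj G) (x∈⁅y⁆⇒x≡y a u∈) (x∈⁅y⁆⇒x≡y c v∈))) ⟩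
      ∣ ⊥ {n} ∣ + 1          ≡⟨ cong (_+ 1) (∣⊥∣≡0 n) ⟩
      1                      ∎)
    where
    open ≤-Reasoning

    a c : Fin n
    a = element (exterior G B) i
    c = element (exterior G B) j

    disjoint : ∀ {z} → z ∈ ⁅ a ⁆ → z ∉ ⁅ c ⁆
    disjoint z∈⁅a⁆ z∈⁅c⁆ =
      i≢j (element-injective (exterior G B)
        (trans (sym (x∈⁅y⁆⇒x≡y a z∈⁅a⁆)) (x∈⁅y⁆⇒x≡y c z∈⁅c⁆)))

    pair⊆ : ⁅ a ⁆ ∪ ⁅ c ⁆ ⊆ epn G ⊥ B ∪ exterior G B
    pair⊆ z∈ with x∈p∪q⁻ ⁅ a ⁆ ⁅ c ⁆ z∈
    ... | inj₁ z∈⁅a⁆ rewrite x∈⁅y⁆⇒x≡y a z∈⁅a⁆ = x∈p∪q⁺ (inj₂ (element-∈ (exterior G B) i))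
    ... | inj₂ z∈⁅c⁆ rewrite x∈⁅y⁆⇒x≡y c z∈⁅c⁆ = x∈p∪q⁺ (inj₂ (element-∈ (exterior G B) j))

  -- A vertex of `I ─ B` has no neighbour in `I`, so all its neighbours in `B` lie in `B ─ I`. If it
  -- has any it is a private neighbour of `B ─ I`; otherwise it is exterior.
  independent-─-⊆ : ∀ {I} B → Independent G I → I ─ B ⊆ epn G (B ─ I) B ∪ exterior G B
  independent-─-⊆ {I} B I-ind {v} v∈ with v ∈? closedNbhd G B
  ... | no v∉N[B] = x∈p∪q⁺ (inj₂ (x∉p⇒x∈∁p v∉N[B]))
  ... | yes v∈N[B] = x∈p∪q⁺ (inj₁ (x∈p∧x∉q⇒x∈p─q v∈N[B─I] v∉N))
    where
    v∉B : v ∉ B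
    v∉B = x∈p─q⇒x∉q I B v∈

    I-≁v : ∀ {b} → b ∈ I → ¬ Adj G b v
    I-≁v b∈I = I-ind _ b∈I v (p─q⊆p I B v∈)

    v∈N[B─I] : v ∈ openNbhd G (B ─ I)
    v∈N[B─I] with ∈-openNbhd⁻ B (x∈p∧x∉q⇒x∈p─q v∈N[B] v∉B)
    ... | _ , b , b∈B , b∼v =
      ∈-openNbhd⁺ (x∈p∧x∉q⇒x∈p─q b∈B λ b∈I → I-≁v b∈I b∼v) b∼v (v∉B ∘ p─q⊆p B I)

    -- `B ─ (B ─ I)` is `B ∩ I`, and no vertex of `I` is adjacent to `v`.
    v∉N : v ∉ openNbhd G (B ─ (B ─ I))
    v∉N v∈N with ∈-openNbhd⁻ (B ─ (B ─ I)) v∈N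
    ... | _ , b , b∈ , b∼v = x∈p─q⇒x∉q B (B ─ I) b∈
      (x∈p∧x∉q⇒x∈p─q (p─q⊆p B (B ─ I) b∈) λ b∈I → I-≁v b∈I b∼v)

  -- An independent `I` splits into `I ∩ B` and `I ─ B`. Bounding the latter by the hypothesis at
  -- `B ─ I` makes the two pieces of `B` reassemble, with one vertex to spare.
  epn-bound⇒α≤∣B∣+1 :
    ∀ B → (∀ B′ → B′ ⊆ B → α (induced G (epn G B′ B ∪ exterior G B)) ≤ ∣ B′ ∣ + 1) →
    α G ≤ ∣ B ∣ + 1
  epn-bound⇒α≤∣B∣+1 B bound = α-least G λ I I-ind → begin
    ∣ I ∣                             ≡⟨ ∣p∩q∣+∣p─q∣≡∣p∣ I B ⟨
    ∣ I ∩ B ∣ + ∣ I ─ B ∣             ≤⟨ +-monoʳ-≤ ∣ I ∩ B ∣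
                                           (≤-trans
                                             (∣I∣≤α-induced G (independent-─-⊆ B I-ind)
                                               (independent-⊆ G (p─q⊆p I B) I-ind))
                                             (bound (B ─ I) (p─q⊆p B I))) ⟩
    ∣ I ∩ B ∣ + (∣ B ─ I ∣ + 1)       ≡⟨ +-assoc ∣ I ∩ B ∣ ∣ B ─ I ∣ 1 ⟨
    ∣ I ∩ B ∣ + ∣ B ─ I ∣ + 1         ≡⟨ cong (λ p → ∣ p ∣ + ∣ B ─ I ∣ + 1) (∩-comm I B) ⟩
    ∣ B ∩ I ∣ + ∣ B ─ I ∣ + 1         ≡⟨ cong (_+ 1) (∣p∩q∣+∣p─q∣≡∣p∣ B I) ⟩
    ∣ B ∣ + 1                         ∎
    where open ≤-Reasoning

proposition12 : ∀ {n : ℕ} (G : Graph n) → HasEdge G →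
    (αₑₛ G ≡ α G ∸ 1) ⇔
    ((∃ λ m → 2 ≤ m × G ≅ K m) ⊎
     (∀ (B : Subset n) → MaximumESI G B →
       Complete (induced G (exterior G B)) ×
       (∀ (B′ : Subset n) → B′ ⊆ B →
         α (induced G (epn G B′ B ∪ exterior G B)) ≤ ∣ B′ ∣ + 1)))
proposition12 {n} G edge = mk⇔ necessary sufficient
  where
  Conditions : Subset n → Set
  Conditions B =
    Complete (induced G (exterior G B)) ×
    (∀ (B′ : Subset n) → B′ ⊆ B →
      α (induced G (epn G B′ B ∪ exterior G B)) ≤ ∣ B′ ∣ + 1)

  necessary : αₑₛ G ≡ α G ∸ 1 →
              (∃ λ m → 2 ≤ m × G ≅ K m) ⊎ (∀ B → MaximumESI G B → Conditions B)
  necessary αₑₛ≡α∸1 = inj₂ λ B ((B-ind , _) , ∣B∣≡αₑₛ) →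
    let α≤∣B∣+1 : α G ≤ ∣ B ∣ + 1
        -- `α G ≤ 1 + (α G ∸ 1)` holds for truncated subtraction too, and `α G ∸ 1` is `∣ B ∣`.
        α≤∣B∣+1 = subst (α G ≤_) (trans (+-comm 1 _) (cong (_+ 1) (sym (trans ∣B∣≡αₑₛ αₑₛ≡α∸1))))
                    (m≤n+m∸n (α G) 1)
    in exterior-complete G B-ind α≤∣B∣+1 ,
       λ B′ B′⊆B → α-induced-least G _ λ I → independent-bound G B-ind B′⊆B α≤∣B∣+1

  sufficient : (∃ λ m → 2 ≤ m × G ≅ K m) ⊎ (∀ B → MaximumESI G B → Conditions B) →
               αₑₛ G ≡ α G ∸ 1
  -- Completeness gives `α G ≤ 1`, so `α G ∸ 1` is 0 and the lower bound on `αₑₛ G` is trivial.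
  sufficient (inj₁ (_ , _ , G≅K)) = ≤-antisym (αₑₛ≤α∸1 G edge)
    (≤-trans (∸-monoˡ-≤ 1 (α-complete G (≅K⇒complete G G≅K))) z≤n)
  sufficient (inj₂ conditions) with ∃-maximumESI G
  ... | B , B-max@(_ , ∣B∣≡αₑₛ) = ≤-antisym (αₑₛ≤α∸1 G edge)
    (subst (α G ∸ 1 ≤_) (trans (m+n∸n≡m ∣ B ∣ 1) ∣B∣≡αₑₛ)
      (∸-monoˡ-≤ 1 (epn-bound⇒α≤∣B∣+1 G B (proj₂ (conditions B B-max)))))
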